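{- There exists an absolute constant $c>0$ such that for every integer $n\ge 1$ and any connected graphs $G_1$ and $G_2$ each having at least $n$ vertices, $$\operatorname{gm}(G_1\mathbin{\Box} G_2)\ \ge\ c\sqrt{n},$$ i.e. $\operatorname{gm}(G_1\mathbin{\Box} G_2)\in\Omega(\sqrt{n})$.
   Context: All graphs are finite, simple and undirected. For a positive integer $k$, the $k\times k$ grid $\boxplus_k$ is the graph with vertex set $\{1,\dots,k\}^2$ in which $(x,y)$ and $(x',y')$ are adjacent iff $|x-x'|+|y-y'|=1$. For a graph $G$, $\operatorname{gm}(G)$ denotes the maximum integer $k$ such that $\boxplus_k$ is a minor of $G$. The Cartesian product $G_1\mathbin{\Box} G_2$ has vertex set $V(G_1)\times V(G_2)$, with distinct vertices $(u_1,u_2),(v_1,v_2)$ adjacent iff either $u_1=v_1$ and $u_2v_2\in E(G_2)$, or $u_2=v_2$ and $u_1v_1\in E(G_1)$. -}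

module Defs where

open import Level using (0ℓ)
open import Data.Nat using (ℕ; zero; suc; _+_; _*_; _≤_; ∣_-_∣)
open import Data.Nat.Properties using (∣-∣-comm; ∣n-n∣≡0)
import Data.Nat.Properties as ℕP
open import Data.Fin using (Fin; toℕ)
import Data.Fin.Properties as FinP
open import Data.Product using (Σ; ∃; ∃-syntax; _×_; _,_; proj₁; proj₂)
open import Data.Product.Properties using (≡-dec)
open import Data.Product.Function.NonDependent.Propositional using (_×-↔_)
open import Data.Sum using (_⊎_; inj₁; inj₂)
open import Data.Unit using (⊤; tt)
open import Data.Empty using (⊥)
open import Function.Bundles using (_↔_)
open import Function.Properties.Inverse using (↔-trans)
open import Relation.Nullary using (¬_; Dec; yes; no)
open import Relation.Nullary.Decidable using (_×-dec_; _⊎-dec_)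
open import Relation.Binary.Definitions using (DecidableEquality; Decidable)
open import Relation.Binary.PropositionalEquality using (_≡_; refl; sym; trans; subst; cong)

record Graph : Set₁ where
  field
    V      : Set
    size   : ℕ
    enum   : Fin size ↔ V
    _≟_    : DecidableEquality V
    E      : V → V → Set
    E-dec  : Decidable E
    E-sym  : ∀ {u v} → E u v → E v u
    E-irr  : ∀ {v} → ¬ E v v

open Graph public

∣V∣ : Graph → ℕ
∣V∣ G = size G

data WalkIn (G : Graph) (P : V G → Set) : V G → V G → Set where
  here : ∀ {v} → P v → WalkIn G P v v
  step : ∀ {u w v} → P u → E G u w → WalkIn G P w v → WalkIn G P u v

Connected : Graph → Set
Connected G = ∀ u v → WalkIn G (λ _ → ⊤) u v

record MinorModel (H G : Graph) : Set₁ where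
  field
    B          : V H → V G → Set
    nonempty   : ∀ h → ∃[ g ] B h g
    disjoint   : ∀ {h h' g} → B h g → B h' g → h ≡ h'
    connected  : ∀ {h g g'} → B h g → B h g' → WalkIn G (B h) g g'
    edges      : ∀ {h h'} → E H h h' →
                 ∃[ g ] ∃[ g' ] (B h g × B h' g' × E G g g')

_≼_ : Graph → Graph → Set₁
H ≼ G = MinorModel H G

-- The k × k grid: vertices Fin k × Fin k (coordinates 0..k-1, i.e. a
-- shift of {1..k}²), (x,y) ~ (x',y') iff |x-x'| + |y-y'| = 1.

grid-E : ∀ k → Fin k × Fin k → Fin k × Fin k → Set
grid-E k (x , y) (x' , y') = ∣ toℕ x - toℕ x' ∣ + ∣ toℕ y - toℕ y' ∣ ≡ 1

private
  grid-sym : ∀ k {u v} → grid-E k u v → grid-E k v u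
  grid-sym k {x , y} {x' , y'} e =
    trans (cong₂' (∣-∣-comm (toℕ x') (toℕ x)) (∣-∣-comm (toℕ y') (toℕ y))) e
    where
    cong₂' : ∀ {a b c d : ℕ} → a ≡ b → c ≡ d → a + c ≡ b + d
    cong₂' refl refl = refl

  grid-irr : ∀ k {v} → ¬ grid-E k v v
  grid-irr k {x , y} e
    rewrite ∣n-n∣≡0 (toℕ x) | ∣n-n∣≡0 (toℕ y) with e
  ... | ()

Grid : ℕ → Graph
Grid k = record
  { V     = Fin k × Fin k
  ; size  = k * k
  ; enum  = FinP.*↔×
  ; _≟_   = ≡-dec FinP._≟_ FinP._≟_
  ; E     = grid-E k
  ; E-dec = λ { (x , y) (x' , y') →
              (∣ toℕ x - toℕ x' ∣ + ∣ toℕ y - toℕ y' ∣) ℕP.≟ 1 }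
  ; E-sym = λ {u} {v} → grid-sym k {u} {v}
  ; E-irr = λ {v} → grid-irr k {v}
  }

□-E : (G₁ G₂ : Graph) → V G₁ × V G₂ → V G₁ × V G₂ → Set
□-E G₁ G₂ (u₁ , u₂) (v₁ , v₂) =
  (u₁ ≡ v₁ × E G₂ u₂ v₂) ⊎ (u₂ ≡ v₂ × E G₁ u₁ v₁)

private
  □-sym : ∀ G₁ G₂ {u v} → □-E G₁ G₂ u v → □-E G₁ G₂ v u
  □-sym G₁ G₂ (inj₁ (p , e)) = inj₁ (sym p , E-sym G₂ e)
  □-sym G₁ G₂ (inj₂ (p , e)) = inj₂ (sym p , E-sym G₁ e)

  □-irr : ∀ G₁ G₂ {v} → ¬ □-E G₁ G₂ v v
  □-irr G₁ G₂ (inj₁ (_ , e)) = E-irr G₂ e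
  □-irr G₁ G₂ (inj₂ (_ , e)) = E-irr G₁ e

_□_ : Graph → Graph → Graph
G₁ □ G₂ = record
  { V     = V G₁ × V G₂
  ; size  = size G₁ * size G₂
  ; enum  = ↔-trans FinP.*↔× (enum G₁ ×-↔ enum G₂)
  ; _≟_   = ≡-dec (_≟_ G₁) (_≟_ G₂)
  ; E     = □-E G₁ G₂
  ; E-dec = λ { (u₁ , u₂) (v₁ , v₂) →
              ((_≟_ G₁ u₁ v₁) ×-dec (E-dec G₂ u₂ v₂)) ⊎-dec
              ((_≟_ G₂ u₂ v₂) ×-dec (E-dec G₁ u₁ v₁)) }
  ; E-sym = □-sym G₁ G₂
  ; E-irr = □-irr G₁ G₂
  }

-- "gm(G) ≥ k" : the k × k grid is a minor of G.  Since gm(G) is the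
-- maximum k with Grid k ≼ G, gm(G) ≥ k holds iff some k' ≥ k has
-- Grid k' ≼ G; we state the theorem by exhibiting such a grid.

GridMinor : ℕ → Graph → Set₁
GridMinor k G = Grid k ≼ G

{-# OPTIONS --safe #-}
module Submission where

-- Put k = 2m with n about 18 m², and choose spanning trees of 18 m² + 1 vertices of G₁ and G₂
-- in a search order, so that every initial segment is connected. If both trees have depth at
-- least k - 1, the product of two root paths contains the grid. Otherwise one of them, say
-- that of G₂, has fewer than k levels, hence contains m disjoint blocks of 3k vertices of equal
-- depth. From each block, two rows of k vertices are selected, so that every selected proper
-- descendant of a vertex y_ij of row i lies in row i + 2 or later. Cut the first k² vertices of
-- the order on G₁ into k rows of vertices x_ij. With indices starting at 0, the branch set of
-- (i , j) is the union of
--   {x_ij} × {proper ancestors of rows 0, ..., i + 1 of the y's}   and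
--   {first k (i + 1) vertices of G₁} × {y_ij}.
-- They are disjoint because of the gap between the rows, and those of (i , j) and (i′ , j′)
-- touch for i ≤ i′ ≤ i + 1, at x_ij and the edge from y_i′j′ to its parent.

open import Defs
open import Data.Nat using (ℕ; zero; suc; _+_; _*_; _∸_; _/_; _%_; _≤_; _<_; z≤n; s≤s; s≤s⁻¹;
  ∣_-_∣; _<?_; _≤?_; NonZero; >-nonZero⁻¹)
open import Data.Nat.Properties renaming (_≟_ to _≟ℕ_)
open import Data.Nat.DivMod using (m≡m%n+[m/n]*n; m%n<n; m/n*n≤m)
open import Data.Nat.Induction using (<-rec)
open import Data.Nat.Tactic.RingSolver using (solve-∀)
open import Data.Fin as Fin using (Fin; toℕ; combine; fromℕ<)
open import Data.Fin.Properties as Fin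
  using (toℕ-injective; toℕ<n; toℕ-fromℕ<; combine-injective; toℕ-combine; any?; injective⇒≤)
open import Data.List using (List; []; _∷_; _++_; length; take; drop; filter; lookup; upTo)
open import Data.List.Properties using (length-take; length-drop; length-++; length-upTo)
open import Data.List.Membership.Propositional using (_∈_; find; lose)
open import Data.List.Membership.Propositional.Properties
  using (∈-filter⁻; ∈-lookup; ∈-++⁻; ∈-upTo⁻)
open import Data.List.Relation.Unary.Any using (Any; here; there) renaming (any? to anyL?)
open import Data.List.Relation.Unary.All as All using (All; []; _∷_)
import Data.List.Relation.Unary.All.Properties as All
open import Data.List.Relation.Unary.AllPairs using (AllPairs; []; _∷_)
import Data.List.Relation.Unary.AllPairs.Properties as AllPairs
open import Data.List.Relation.Unary.Linked using (Linked; []; [-]; _∷_)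
open import Data.List.Relation.Unary.Unique.Propositional using (Unique)
import Data.List.Relation.Unary.Unique.Propositional.Properties as Unique
open import Data.Product using (Σ; ∃-syntax; _×_; _,_; proj₁; proj₂)
open import Data.Sum using (_⊎_; inj₁; inj₂)
open import Data.Empty using (⊥; ⊥-elim)
open import Function using (_∘_; case_of_)
open import Function.Bundles using (Inverse)
open import Relation.Nullary using (¬_; Dec; yes; no; contradiction; ¬?)
open import Relation.Nullary.Decidable using (decidable-stable)
open import Relation.Unary using () renaming (Decidable to Decidable₁)
open import Relation.Binary.Definitions using (Decidable; tri<; tri≈; tri>)
open import Relation.Binary.PropositionalEquality

-- Walks, and minors under exchange of the factors.

module _ {G : Graph} where

  walk-start : ∀ {P u v} → WalkIn G P u v → P u
  walk-start (here p)     = p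
  walk-start (step p _ _) = p

  walk-trans : ∀ {P u v w} → WalkIn G P u v → WalkIn G P v w → WalkIn G P u w
  walk-trans (here _)     w′ = w′
  walk-trans (step p e w) w′ = step p e (walk-trans w w′)

  walk-reverse : ∀ {P u v} → WalkIn G P u v → WalkIn G P v u
  walk-reverse (here p)     = here p
  walk-reverse (step p e w) =
    walk-trans (walk-reverse w) (step (walk-start w) (E-sym G e) (here p))

  -- Supplies the edge by which a partial search tree grows.
  walk-exit : ∀ {P} {Q : V G → Set} → (∀ x → Dec (Q x)) → ∀ {u v} → Q u → ¬ Q v →
              WalkIn G P u v → ∃[ a ] ∃[ b ] (Q a × ¬ Q b × E G a b)
  walk-exit Q? qu ¬qv (here _) = contradiction qu ¬qv
  walk-exit Q? qu ¬qv (step {w = w} _ e ws) with Q? w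
  ... | yes qw = walk-exit Q? qw ¬qv ws
  ... | no ¬qw = _ , w , qu , ¬qw , e

walk-map : ∀ {G G′ : Graph} (f : V G → V G′) → (∀ {u v} → E G u v → E G′ (f u) (f v)) →
           ∀ {P : V G → Set} {P′ : V G′ → Set} → (∀ {u} → P u → P′ (f u)) →
           ∀ {u v} → WalkIn G P u v → WalkIn G′ P′ (f u) (f v)
walk-map f fE fP (here p)     = here (fP p)
walk-map f fE fP (step p e w) = step (fP p) (fE e) (walk-map f fE fP w)

minor-swap : ∀ {H} G₁ G₂ → H ≼ (G₂ □ G₁) → H ≼ (G₁ □ G₂)
minor-swap {H} G₁ G₂ M = record
  { B         = λ { h (u , v) → B h (v , u) }
  ; nonempty  = λ h → let ((v , u) , b) = nonempty h in (u , v) , b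
  ; disjoint  = disjoint
  ; connected = λ b b′ → walk-map {G₂ □ G₁} {G₁ □ G₂} swap-V swap-E (λ p → p) (connected b b′)
  ; edges     = λ e → let ((v , u) , (v′ , u′) , b , b′ , e′) = edges e
                      in (u , v) , (u′ , v′) , b , b′ , swap-E e′
  }
  where
  open MinorModel M
  swap-V : V G₂ × V G₁ → V G₁ × V G₂
  swap-V (v , u) = u , v
  swap-E : ∀ {p q} → E (G₂ □ G₁) p q → E (G₁ □ G₂) (swap-V p) (swap-V q)
  swap-E (inj₁ x) = inj₂ x
  swap-E (inj₂ x) = inj₁ x

-- Edges of the grid.

∣m-n∣≡1⇒ : ∀ m n → ∣ m - n ∣ ≡ 1 → n ≡ suc m ⊎ m ≡ suc n
∣m-n∣≡1⇒ zero    n       eq = inj₁ eq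
∣m-n∣≡1⇒ (suc m) zero    eq = inj₂ eq
∣m-n∣≡1⇒ (suc m) (suc n) eq with ∣m-n∣≡1⇒ m n eq
... | inj₁ p = inj₁ (cong suc p)
... | inj₂ p = inj₂ (cong suc p)

m+n≡1⇒ : ∀ m n → m + n ≡ 1 → (m ≡ 0 × n ≡ 1) ⊎ (m ≡ 1 × n ≡ 0)
m+n≡1⇒ zero          n eq = inj₁ (refl , eq)
m+n≡1⇒ (suc zero)    n eq = inj₂ (refl , suc-injective eq)

grid-edge-rec : ∀ {k} (Q : V (Grid k) → V (Grid k) → Set) →
                (∀ {u v} → Q u v → Q v u) →
                (∀ i j j′ → toℕ j′ ≡ suc (toℕ j) → Q (i , j) (i , j′)) →
                (∀ i i′ j → toℕ i′ ≡ suc (toℕ i) → Q (i , j) (i′ , j)) →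
                ∀ {u v} → E (Grid k) u v → Q u v
grid-edge-rec Q Q-sym Qʰ Qᵛ {i , j} {i′ , j′} e
  with m+n≡1⇒ ∣ toℕ i - toℕ i′ ∣ ∣ toℕ j - toℕ j′ ∣ e
... | inj₁ (i≡ , j~) with toℕ-injective {i = i} {i′} (∣m-n∣≡0⇒m≡n i≡) | ∣m-n∣≡1⇒ (toℕ j) (toℕ j′) j~
...   | refl | inj₁ p = Qʰ i j j′ p
...   | refl | inj₂ p = Q-sym (Qʰ i j′ j p)
grid-edge-rec Q Q-sym Qʰ Qᵛ {i , j} {i′ , j′} e | inj₂ (i~ , j≡)
  with toℕ-injective {i = j} {j′} (∣m-n∣≡0⇒m≡n j≡) | ∣m-n∣≡1⇒ (toℕ i) (toℕ i′) i~
...   | refl | inj₁ p = Qᵛ i i′ j p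
...   | refl | inj₂ p = Q-sym (Qᵛ i′ i j p)

-- Rooted trees on the natural numbers and their ancestor order.

-- The root is 0 and par t is the parent of the vertex suc t.
record RootedTree : Set where
  field
    par     : ℕ → ℕ
    dep     : ℕ → ℕ
    par≤    : ∀ t → par t ≤ t
    dep-0   : dep 0 ≡ 0
    dep-suc : ∀ t → dep (suc t) ≡ suc (dep (par t))

module TreeOrder (T : RootedTree) where
  open RootedTree T

  data _⊑_ (a : ℕ) : ℕ → Set where
    ⊑-refl : a ⊑ a
    ⊑-step : ∀ {t} → a ⊑ par t → a ⊑ suc t

  -- Proper ancestors. The root has none, as `a < zero` is empty; the other clause makes `a ⊏ suc t`
  -- compute to a statement about the parent.
  _⊏_ : ℕ → ℕ → Set
  a ⊏ zero  = a < zero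
  a ⊏ suc t = a ⊑ par t

  ⊑⇒dep≤ : ∀ {a t} → a ⊑ t → dep a ≤ dep t
  ⊑⇒dep≤ ⊑-refl             = ≤-refl
  ⊑⇒dep≤ (⊑-step {t} a⊑par) =
    ≤-trans (⊑⇒dep≤ a⊑par) (≤-trans (n≤1+n _) (≤-reflexive (sym (dep-suc t))))

  0⊑ : ∀ t → 0 ⊑ t
  0⊑ = <-rec _ λ { zero _ → ⊑-refl ; (suc t) rec → ⊑-step (rec (s≤s (par≤ t))) }

  par-⊑ : ∀ {a t} → suc a ⊑ t → par a ⊑ t
  par-⊑ ⊑-refl         = ⊑-step ⊑-refl
  par-⊑ (⊑-step a⊑par) = ⊑-step (par-⊑ a⊑par)

  ⊏⇒dep< : ∀ {a t} → a ⊏ t → dep a < dep t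
  ⊏⇒dep< {t = suc t} a⊏t = ≤-trans (s≤s (⊑⇒dep≤ a⊏t)) (≤-reflexive (sym (dep-suc t)))

  par-⊏ : ∀ {a t} → suc a ⊏ t → par a ⊏ t
  par-⊏ {t = suc t} = par-⊑

  -- Both lie on the path from `t` to the root, along which depth strictly decreases. Hence distinct
  -- vertices of equal depth have no common descendant.
  ⊑-unique : ∀ {a b t} → a ⊑ t → b ⊑ t → dep a ≡ dep b → a ≡ b
  ⊑-unique ⊑-refl     ⊑-refl     eq = refl
  ⊑-unique ⊑-refl     (⊑-step p) eq = contradiction (sym eq) (<⇒≢ (⊏⇒dep< p))
  ⊑-unique (⊑-step p) ⊑-refl     eq = contradiction eq (<⇒≢ (⊏⇒dep< p))
  ⊑-unique (⊑-step p) (⊑-step q) eq = ⊑-unique p q eq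

  ⊏-unique : ∀ {a b t} → a ⊏ t → b ⊏ t → dep a ≡ dep b → a ≡ b
  ⊏-unique {t = suc t} = ⊑-unique

  _⊑?_ : Decidable _⊑_
  a ⊑? t = <-rec (λ t → Dec (a ⊑ t)) go t
    where
    go : ∀ t → (∀ {s} → s < t → Dec (a ⊑ s)) → Dec (a ⊑ t)
    go t rec with a ≟ℕ t
    ... | yes refl = yes ⊑-refl
    go zero    rec | no a≢t = no λ { ⊑-refl → a≢t refl }
    go (suc t) rec | no a≢t with rec (s≤s (par≤ t))
    ... | yes p = yes (⊑-step p)
    ... | no ¬p = no λ { ⊑-refl → a≢t refl ; (⊑-step p) → ¬p p }

  _⊏?_ : Decidable _⊏_
  a ⊏? zero  = no λ ()
  a ⊏? suc t = a ⊑? par t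

  -- A set of tree vertices closed under parents is connected through the root. The map `w` allows
  -- the tree to be a copy of either factor's tree inside the product.
  climb : (G : Graph) (w : ℕ → V G) (U : ℕ → Set) (Q : V G → Set) →
          (∀ {t} → U (suc t) → U (par t)) →
          (∀ {t} → U (suc t) → E G (w (suc t)) (w (par t))) →
          (∀ {t} → U t → Q (w t)) →
          ∀ t → U t → WalkIn G Q (w t) (w 0)
  climb G w U Q up edge U⇒Q = <-rec _ go
    where
    go : ∀ t → (∀ {s} → s < t → U s → WalkIn G Q (w s) (w 0)) →
         U t → WalkIn G Q (w t) (w 0)
    go zero    rec u = here (U⇒Q u)
    go (suc t) rec u = step (U⇒Q u) (edge u) (rec (s≤s (par≤ t)) (up u))

  -- The root is its own parent here, so that climbing too far agrees with truncated subtraction of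
  -- depths.
  up : ℕ → ℕ
  up zero    = zero
  up (suc t) = par t

  up^ : ℕ → ℕ → ℕ
  up^ zero    t = t
  up^ (suc n) t = up (up^ n t)

  up^≤ : ∀ n t → up^ n t ≤ t
  up^≤ zero    t = ≤-refl
  up^≤ (suc n) t = ≤-trans (up≤ (up^ n t)) (up^≤ n t)
    where
    up≤ : ∀ t → up t ≤ t
    up≤ zero    = z≤n
    up≤ (suc t) = m≤n⇒m≤1+n (par≤ t)

  dep-up^ : ∀ n t → dep (up^ n t) ≡ dep t ∸ n
  dep-up^ zero    t = refl
  dep-up^ (suc n) t = begin
    dep (up (up^ n t))  ≡⟨ dep-up (up^ n t) ⟩
    dep (up^ n t) ∸ 1   ≡⟨ cong (_∸ 1) (dep-up^ n t) ⟩
    dep t ∸ n ∸ 1       ≡⟨ ∸-+-assoc (dep t) n 1 ⟩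
    dep t ∸ (n + 1)     ≡⟨ cong (dep t ∸_) (+-comm n 1) ⟩
    dep t ∸ suc n       ∎
    where
    open ≡-Reasoning
    dep-up : ∀ t → dep (up t) ≡ dep t ∸ 1
    dep-up zero    rewrite dep-0 = refl
    dep-up (suc t) rewrite dep-suc t = refl

  -- The ancestor of `t` at depth `i`, meaningful for `i ≤ dep t`.
  ancestorAt : ℕ → ℕ → ℕ
  ancestorAt t i = up^ (dep t ∸ i) t

  dep-ancestorAt : ∀ {t i} → i ≤ dep t → dep (ancestorAt t i) ≡ i
  dep-ancestorAt {t} {i} i≤ = trans (dep-up^ (dep t ∸ i) t) (m∸[m∸n]≡n i≤)

  -- Its depth being positive, the ancestor at depth `suc i` is not the root, and one more climb
  -- leads to the ancestor at depth `i`.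
  ancestorAt-suc : ∀ {t i} → suc i ≤ dep t →
                   ∃[ s ] (ancestorAt t (suc i) ≡ suc s × ancestorAt t i ≡ par s)
  ancestorAt-suc {t} {i} i<
    with ancestorAt t (suc i) in eq | dep-ancestorAt {t} {suc i} i<
  ... | zero  | d = contradiction (trans (sym dep-0) d) λ ()
  ... | suc s | _ = s , refl , trans (cong (λ n → up^ n t) (+-∸-assoc 1 i<)) (cong up eq)

-- Search trees in connected graphs.

record SpanningSequence (G : Graph) (N : ℕ) : Set where
  field
    tree   : RootedTree
  open RootedTree tree public
  field
    v      : ℕ → V G
    v-inj  : ∀ {s t} → s < N → t < N → v s ≡ v t → s ≡ t
    v-edge : ∀ {t} → suc t < N → E G (v (suc t)) (v (par t))
    -- Indices from `N` on carry no vertex of the tree. Hanging them from the root ensures that the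
    -- next index to be filled has no children.
    par-outside : ∀ {t} → N ≤ suc t → par t ≡ 0
  open TreeOrder tree public

override : ∀ {A : Set} → ℕ → A → (ℕ → A) → ℕ → A
override N a f t with t ≟ℕ N
... | yes _ = a
... | no  _ = f t

override-≡ : ∀ {A : Set} N (a : A) f → override N a f N ≡ a
override-≡ N a f with N ≟ℕ N
... | yes _ = refl
... | no ¬p = contradiction refl ¬p

override-≢ : ∀ {A : Set} {N} (a : A) f {t} → t ≢ N → override N a f t ≡ f t
override-≢ {N = N} a f {t} t≢N with t ≟ℕ N
... | yes p = contradiction p t≢N
... | no _  = refl

module _ (G : Graph) where
  open Inverse (enum G) using ()
    renaming (to to vertex; from to index; strictlyInverseʳ to index-vertex)

  vertex-injective : ∀ {x y} → vertex x ≡ vertex y → x ≡ y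
  vertex-injective {x} {y} eq =
    trans (sym (index-vertex x)) (trans (cong index eq) (index-vertex y))

  -- Otherwise choosing preimages under `f` would inject `Fin (size G)` into `Fin N`.
  missing : ∀ {N} (f : ℕ → V G) → N < size G → ∃[ u ] (∀ {t} → t < N → f t ≢ u)
  missing {N} f N<size with any? (λ x → ¬? (anyUpTo? (λ t → _≟_ G (f t) (vertex x)) N))
  ... | yes (x , ∄t) = vertex x , λ t<N eq → ∄t (_ , t<N , eq)
  ... | no  ∄x = contradiction (injective⇒≤ {f = f⁻¹} f⁻¹-injective) (<⇒≱ N<size)
    where
    preimage : ∀ x → ∃[ t ] (t < N × f t ≡ vertex x)
    preimage x = decidable-stable (anyUpTo? (λ t → _≟_ G (f t) (vertex x)) N) (λ ∄t → ∄x (x , ∄t))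
    f⁻¹ : Fin (size G) → Fin N
    f⁻¹ x = fromℕ< (proj₁ (proj₂ (preimage x)))
    f∘f⁻¹ : ∀ x → f (toℕ (f⁻¹ x)) ≡ vertex x
    f∘f⁻¹ x = trans (cong f (toℕ-fromℕ< _)) (proj₂ (proj₂ (preimage x)))
    f⁻¹-injective : ∀ {x y} → f⁻¹ x ≡ f⁻¹ y → x ≡ y
    f⁻¹-injective {x} {y} eq =
      vertex-injective (trans (sym (f∘f⁻¹ x)) (trans (cong (f ∘ toℕ) eq) (f∘f⁻¹ y)))

  spanningSequence-1 : 1 ≤ size G → SpanningSequence G 1
  spanningSequence-1 1≤size = record
    { tree   = record { par = λ _ → 0 ; dep = λ { zero → 0 ; (suc _) → 1 }
                      ; par≤ = λ _ → z≤n ; dep-0 = refl ; dep-suc = λ _ → refl }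
    ; v      = λ _ → vertex (fromℕ< 1≤size)
    ; v-inj  = λ { (s≤s z≤n) (s≤s z≤n) _ → refl }
    ; v-edge = λ { (s≤s ()) }
    ; par-outside = λ _ → refl
    }

  -- A walk from the root to an unlisted vertex leaves the listed set along some edge. Its outer end
  -- `b` is appended, with the inner end, of index `p`, as parent.
  extend : ∀ {n} → Connected G → suc n < size G →
           SpanningSequence G (suc n) → SpanningSequence G (suc (suc n))
  extend {n} conn N<size S
    with missing (SpanningSequence.v S) N<size
  ... | u , u∉ with walk-exit {G} (λ x → anyUpTo? (λ t → _≟_ G (SpanningSequence.v S t) x) (suc n))
                  (0 , s≤s z≤n , refl) (λ { (t , t<N , eq) → u∉ t<N eq })
                  (conn (SpanningSequence.v S 0) u)
  ... | _ , b , (p , p<N , refl) , b∉ , e = record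
    { tree   = record { par = par′ ; dep = dep′ ; par≤ = par′≤ ; dep-0 = dep-0
                      ; dep-suc = dep′-suc }
    ; v      = v′
    ; v-inj  = v′-inj
    ; v-edge = v′-edge
    ; par-outside = par′-outside
    }
    where
    open SpanningSequence S
    par′ : ℕ → ℕ
    par′ = override n p par
    dep′ : ℕ → ℕ
    dep′ zero    = dep 0
    -- The old `dep` may be used on the right: only the depth of `suc n` changes, and `suc n` is
    -- nobody's parent.
    dep′ (suc t) = suc (dep (par′ t))
    v′ : ℕ → V G
    v′ = override (suc n) b v
    par′≤ : ∀ t → par′ t ≤ t
    par′≤ t with t ≟ℕ n
    ... | yes refl = s≤s⁻¹ p<N
    ... | no _     = par≤ t
    dep′≡ : ∀ t → t ≢ suc n → dep′ t ≡ dep t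
    dep′≡ zero    t≢ = refl
    dep′≡ (suc t) t≢ =
      trans (cong (suc ∘ dep) (override-≢ p par (t≢ ∘ cong suc))) (sym (dep-suc t))
    par′-outside : ∀ {t} → suc (suc n) ≤ suc t → par′ t ≡ 0
    par′-outside n<t = trans (override-≢ p par (≢-sym (<⇒≢ (s≤s⁻¹ n<t))))
                             (par-outside (≤-trans (n≤1+n _) n<t))
    par′≢ : ∀ t → par′ t ≢ suc n
    par′≢ t eq with t <? suc n
    ... | yes t≤n = <⇒≢ (≤-<-trans (par′≤ t) t≤n) eq
    ... | no  t≰n with trans (sym eq) (par′-outside (s≤s (≮⇒≥ t≰n)))
    ...   | ()
    dep′-suc : ∀ t → dep′ (suc t) ≡ suc (dep′ (par′ t))
    dep′-suc t = cong suc (sym (dep′≡ (par′ t) (par′≢ t)))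
    v′-inj : ∀ {s t} → s < suc (suc n) → t < suc (suc n) → v′ s ≡ v′ t → s ≡ t
    v′-inj {s} {t} s< t< eq with s ≟ℕ suc n | t ≟ℕ suc n
    ... | yes refl | yes refl = refl
    ... | yes refl | no t≢    =
      contradiction (t , ≤∧≢⇒< (s≤s⁻¹ t<) t≢ , sym eq) b∉
    ... | no s≢    | yes refl = contradiction (s , ≤∧≢⇒< (s≤s⁻¹ s<) s≢ , eq) b∉
    ... | no s≢    | no t≢    = v-inj (≤∧≢⇒< (s≤s⁻¹ s<) s≢) (≤∧≢⇒< (s≤s⁻¹ t<) t≢) eq
    v′-edge : ∀ {t} → suc t < suc (suc n) → E G (v′ (suc t)) (v′ (par′ t))
    v′-edge {t} (s≤s t<) rewrite override-≢ {N = suc n} b v (par′≢ t) with t ≟ℕ n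
    ... | yes refl rewrite override-≡ (suc n) b v = E-sym G e
    ... | no t≢ rewrite override-≢ {N = suc n} b v (t≢ ∘ suc-injective) =
      v-edge (s≤s (≤∧≢⇒< (s≤s⁻¹ t<) t≢))

  spanningSequence : Connected G → ∀ n → suc n ≤ size G → SpanningSequence G (suc n)
  spanningSequence conn zero    1≤size = spanningSequence-1 1≤size
  spanningSequence conn (suc n) n<size =
    extend conn n<size (spanningSequence conn n (≤-trans (n≤1+n _) n<size))

-- Two deep trees: the product of two root paths.

record PathIn (k : ℕ) (G : Graph) : Set where
  field
    p      : Fin k → V G
    p-inj  : ∀ {i j} → p i ≡ p j → i ≡ j
    p-edge : ∀ {i j} → toℕ j ≡ suc (toℕ i) → E G (p i) (p j)

-- The ancestors of `t` at depths 0, ..., k - 1 form the path; their depths tell them apart.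
rootPath : ∀ {G N k} (S : SpanningSequence G N) → let open SpanningSequence S in
           ∀ {t} → t < N → k ≤ suc (dep t) → PathIn k G
rootPath {G} {N} {k} S {t} t<N k≤ = record
  { p      = v ∘ a
  ; p-inj  = λ {i} {j} eq → toℕ-injective
      (trans (sym (dep-a i)) (trans (cong dep (v-inj (a<N i) (a<N j) eq)) (dep-a j)))
  ; p-edge = a-edge
  }
  where
  open SpanningSequence S
  a : Fin k → ℕ
  a i = ancestorAt t (toℕ i)
  i≤dep : ∀ (i : Fin k) → toℕ i ≤ dep t
  i≤dep i = s≤s⁻¹ (≤-trans (toℕ<n i) k≤)
  dep-a : ∀ i → dep (a i) ≡ toℕ i
  dep-a i = dep-ancestorAt (i≤dep i)
  a<N : ∀ i → a i < N
  a<N i = ≤-<-trans (up^≤ (dep t ∸ toℕ i) t) t<N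
  a-edge : ∀ {i j} → toℕ j ≡ suc (toℕ i) → E G (v (a i)) (v (a j))
  a-edge {i} {j} j≡ with ancestorAt-suc (subst (_≤ dep t) j≡ (i≤dep j))
  ... | s , eqj , eqi rewrite eqi =
    subst (λ x → E G (v (par s)) (v x)) (sym aj≡)
      (E-sym G (v-edge (subst (_< N) aj≡ (a<N j))))
    where
    aj≡ : a j ≡ suc s
    aj≡ = trans (cong (ancestorAt t) j≡) eqj

-- The grid is a subgraph of the product of the paths, so singleton branch sets suffice.
grid-of-paths : ∀ {k G₁ G₂} → PathIn k G₁ → PathIn k G₂ → GridMinor k (G₁ □ G₂)
grid-of-paths {k} {G₁} {G₂} P₁ P₂ = record
  { B         = λ h g → g ≡ cell h
  ; nonempty  = λ h → cell h , refl
  ; disjoint  = λ eq eq′ → cell-inj (trans (sym eq) eq′)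
  ; connected = λ { refl refl → here refl }
  ; edges     = λ e → _ , _ , refl , refl , cell-edge e
  }
  where
  open PathIn
  cell : Fin k × Fin k → V G₁ × V G₂
  cell (i , j) = p P₁ i , p P₂ j
  cell-inj : ∀ {h h′} → cell h ≡ cell h′ → h ≡ h′
  cell-inj eq = cong₂ _,_ (p-inj P₁ (cong proj₁ eq)) (p-inj P₂ (cong proj₂ eq))
  cell-edge : ∀ {h h′} → grid-E k h h′ → □-E G₁ G₂ (cell h) (cell h′)
  cell-edge = grid-edge-rec (λ h h′ → □-E G₁ G₂ (cell h) (cell h′)) (E-sym (G₁ □ G₂))
    (λ i j j′ s → inj₁ (refl , p-edge P₂ s))
    (λ i i′ j s → inj₂ (refl , p-edge P₁ s))

-- A shallow second tree: the grid minor from spaced rows.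

-- The entry y i j stands for the vertex suc (y i j), which is therefore not the root.
record SpacedRows (T : RootedTree) (k N : ℕ) : Set where
  open TreeOrder T
  field
    y        : Fin k → Fin k → ℕ
    y<N      : ∀ i j → suc (y i j) < N
    y-inj    : ∀ {i j i′ j′} → y i j ≡ y i′ j′ → (i , j) ≡ (i′ , j′)
    y-spaced : ∀ {i j i′ j′} → suc (y i j) ⊏ suc (y i′ j′) → 2 + toℕ i ≤ toℕ i′

grid-of-spacedRows : ∀ {k G₁ G₂ N₁ N₂} (S₁ : SpanningSequence G₁ N₁) (S₂ : SpanningSequence G₂ N₂) →
                     k * k ≤ N₁ → SpacedRows (SpanningSequence.tree S₂) k N₂ →
                     GridMinor k (G₁ □ G₂)
grid-of-spacedRows {k} {G₁} {G₂} {N₁} {N₂} S₁ S₂ kk≤N₁ Y = record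
  { B         = Branch
  ; nonempty  = λ { (i , j) → hub (i , j) , inj₁ (refl , 0 , 0∈S i j , refl) }
  ; disjoint  = disjoint
  ; connected = λ b b′ → walk-trans (to-hub b) (walk-reverse (to-hub b′))
  ; edges     = grid-edge-rec Touch Touch-sym
      (λ i j j′ _ → touch {i} {j} {i} {j′} ≤-refl (n≤1+n _))
      (λ i i′ j s → touch {i} {j} {i′} {j} (≤-trans (n≤1+n _) (≤-reflexive (sym s))) (≤-reflexive s))
  }
  where
  module S₁ = SpanningSequence S₁
  module S₂ = SpanningSequence S₂
  open S₂ using (_⊏_)
  open SpacedRows Y

  x : Fin k → Fin k → ℕ
  x i j = toℕ (combine i j)
  x<N : ∀ i j → x i j < N₁
  x<N i j = ≤-trans (toℕ<n (combine i j)) kk≤N₁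

  InR : Fin k → ℕ → Set
  InR i a = a < N₁ × a < k * suc (toℕ i)
  InS : Fin k → ℕ → Set
  InS i b = b < N₂ × ∃[ i′ ] ∃[ j′ ] (toℕ i′ ≤ suc (toℕ i) × b ⊏ suc (y i′ j′))

  Branch : Fin k × Fin k → V G₁ × V G₂ → Set
  Branch (i , j) (u , w) =
    (u ≡ S₁.v (x i j) × ∃[ b ] (InS i b × w ≡ S₂.v b)) ⊎
    (w ≡ S₂.v (suc (y i j)) × ∃[ a ] (InR i a × u ≡ S₁.v a))

  hub : Fin k × Fin k → V G₁ × V G₂
  hub (i , j) = S₁.v (x i j) , S₂.v 0

  x<row : ∀ {i i′} j → toℕ i ≤ toℕ i′ → x i j < k * suc (toℕ i′)
  x<row {i} {i′} j i≤i′ = begin-strict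
    x i j               ≡⟨ toℕ-combine i j ⟩
    k * toℕ i + toℕ j   <⟨ +-monoʳ-< (k * toℕ i) (toℕ<n j) ⟩
    k * toℕ i + k       ≡⟨ +-comm (k * toℕ i) k ⟩
    k + k * toℕ i       ≡⟨ *-suc k (toℕ i) ⟨
    k * suc (toℕ i)     ≤⟨ *-monoʳ-≤ k (s≤s i≤i′) ⟩
    k * suc (toℕ i′)    ∎
    where open ≤-Reasoning
  row≤ : ∀ {i i′} j → x i j < k * suc (toℕ i′) → toℕ i ≤ toℕ i′
  row≤ {i} {i′} j x< = s≤s⁻¹ (*-cancelˡ-< k (toℕ i) (suc (toℕ i′)) (begin-strict
    k * toℕ i           ≤⟨ m≤m+n _ (toℕ j) ⟩
    k * toℕ i + toℕ j   ≡⟨ toℕ-combine i j ⟨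
    x i j               <⟨ x< ⟩
    k * suc (toℕ i′)    ∎))
    where open ≤-Reasoning

  par-<N : ∀ {t} → suc t < N₂ → S₂.par t < N₂
  par-<N {t} t<N = ≤-<-trans (S₂.par≤ t) (≤-trans (n≤1+n _) t<N)
  0∈S : ∀ i j → InS i 0
  0∈S i j = ≤-trans (s≤s z≤n) (y<N i j) , i , j , n≤1+n _ , S₂.0⊑ _
  par∈S : ∀ {i i′ j′} → toℕ i′ ≤ suc (toℕ i) → InS i (S₂.par (y i′ j′))
  par∈S {i} {i′} {j′} i′≤ = par-<N (y<N i′ j′) , i′ , j′ , i′≤ , S₂.⊑-refl
  x∈R : ∀ {i i′} j → toℕ i ≤ toℕ i′ → InR i′ (x i j)
  x∈R {i} j i≤i′ = x<N i j , x<row j i≤i′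

  -- The part over `x i j` climbs the second tree to its root. The part at `y i j` is connected
  -- through the root of the first tree; from it, the walk returns to `x i j` and enters the other
  -- part by the edge from `y i j` to its parent.
  to-hub : ∀ {h g} → Branch h g → WalkIn (G₁ □ G₂) (Branch h) g (hub h)
  to-hub {i , j} (inj₁ (refl , b , b∈S , refl)) =
    S₂.climb (G₁ □ G₂) (λ b → S₁.v (x i j) , S₂.v b) (InS i) (Branch (i , j))
      (λ { (t<N , i′ , j′ , i′≤ , t⊏) → par-<N t<N , i′ , j′ , i′≤ , S₂.par-⊏ {t = suc (y i′ j′)} t⊏ })
      (λ { (t<N , _) → inj₁ (refl , S₂.v-edge t<N) })
      (λ {t} t∈S → inj₁ (refl , t , t∈S , refl))
      b b∈S
  to-hub {i , j} (inj₂ (refl , a , a∈R , refl)) =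
    walk-trans (to-root a a∈R) (walk-trans (walk-reverse (to-root (x i j) (x∈R j ≤-refl)))
      (step (inj₂ (refl , x i j , x∈R j ≤-refl , refl)) (inj₁ (refl , S₂.v-edge (y<N i j)))
        (to-hub (inj₁ (refl , _ , par∈S (n≤1+n _) , refl)))))
    where
    to-root : ∀ a → InR i a → WalkIn (G₁ □ G₂) (Branch (i , j))
                (S₁.v a , S₂.v (suc (y i j))) (S₁.v 0 , S₂.v (suc (y i j)))
    to-root = S₁.climb (G₁ □ G₂) (λ a → S₁.v a , S₂.v (suc (y i j))) (InR i) (Branch (i , j))
      (λ { {t} (t<N , t<) → ≤-<-trans (S₁.par≤ t) (≤-trans (n≤1+n _) t<N)
                          , ≤-<-trans (S₁.par≤ t) (≤-trans (n≤1+n _) t<) })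
      (λ { (t<N , _) → inj₂ (refl , S₁.v-edge t<N) })
      (λ {t} t∈R → inj₂ (refl , t , t∈R , refl))

  Touch : Fin k × Fin k → Fin k × Fin k → Set
  Touch h h′ = ∃[ g ] ∃[ g′ ] (Branch h g × Branch h′ g′ × E (G₁ □ G₂) g g′)
  Touch-sym : ∀ {h h′} → Touch h h′ → Touch h′ h
  Touch-sym (g , g′ , b , b′ , e) = g′ , g , b′ , b , E-sym (G₁ □ G₂) e
  -- `i ≤ i′` puts `x i j` into `InR i′`, and `i′ ≤ i + 1` puts the parent of `y i′ j′` into
  -- `InS i`. Horizontal and vertical grid edges are both instances.
  touch : ∀ {i j i′ j′} → toℕ i ≤ toℕ i′ → toℕ i′ ≤ suc (toℕ i) → Touch (i , j) (i′ , j′)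
  touch {i} {j} {i′} {j′} i≤i′ i′≤ =
    (S₁.v (x i j) , S₂.v (S₂.par (y i′ j′))) , (S₁.v (x i j) , S₂.v (suc (y i′ j′))) ,
    inj₁ (refl , _ , par∈S i′≤ , refl) , inj₂ (refl , x i j , x∈R j i≤i′ , refl) ,
    inj₁ (refl , E-sym G₂ (S₂.v-edge (y<N i′ j′)))

  -- From `x i j` in `InR i′` follows `i ≤ i′`. As a member of `InS i`, `y i′ j′` is a proper
  -- ancestor of some `y i″ j″` with `i″ ≤ i + 1`, while spacing requires `i′ + 2 ≤ i″`.
  clash : ∀ {i j i′ j′ a b} → S₁.v (x i j) ≡ S₁.v a → InR i′ a →
          S₂.v (suc (y i′ j′)) ≡ S₂.v b → InS i b → ⊥
  clash {i} {j} {i′} {j′} eq (a<N , a<) eq′ (b<N , i″ , j″ , i″≤ , b⊏)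
    with S₁.v-inj (x<N i j) a<N eq | S₂.v-inj (y<N i′ j′) b<N eq′
  ... | refl | refl = 1+n≰n (begin
    suc (suc (toℕ i′))  ≤⟨ y-spaced b⊏ ⟩
    toℕ i″              ≤⟨ i″≤ ⟩
    suc (toℕ i)         ≤⟨ s≤s (row≤ {i} {i′} j a<) ⟩
    suc (toℕ i′)        ∎)
    where open ≤-Reasoning

  disjoint : ∀ {h h′ g} → Branch h g → Branch h′ g → h ≡ h′
  disjoint {i , j} {i′ , j′} (inj₁ (refl , _)) (inj₁ (eq , _))
    with combine-injective i j i′ j′ (toℕ-injective (S₁.v-inj (x<N i j) (x<N i′ j′) eq))
  ... | refl , refl = refl
  disjoint {i , j} {i′ , j′} (inj₂ (refl , _)) (inj₂ (eq , _)) =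
    y-inj (suc-injective (S₂.v-inj (y<N i j) (y<N i′ j′) eq))
  disjoint {i , j} {i′ , j′} (inj₁ (refl , b , b∈S , refl)) (inj₂ (eq′ , a , a∈R , eq)) =
    ⊥-elim (clash {i} {j} {i′} {j′} eq a∈R (sym eq′) b∈S)
  disjoint {i , j} {i′ , j′} (inj₂ (eq′ , a , a∈R , eq)) (inj₁ (refl , b , b∈S , eq″)) =
    ⊥-elim (clash {i′} {j′} {i} {j} eq a∈R (trans (sym eq′) eq″) b∈S)

-- Sublists and positions in lists.

module _ {A : Set} where

  ∈-take⁻ : ∀ n {xs : List A} {a} → a ∈ take n xs → a ∈ xs
  ∈-take⁻ (suc n) {x ∷ xs} (here eq)  = here eq
  ∈-take⁻ (suc n) {x ∷ xs} (there a∈) = there (∈-take⁻ n a∈)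

  ∈-drop⁻ : ∀ n {xs : List A} {a} → a ∈ drop n xs → a ∈ xs
  ∈-drop⁻ zero             a∈ = a∈
  ∈-drop⁻ (suc n) {x ∷ xs} a∈ = there (∈-drop⁻ n a∈)

  take-drop-≢ : ∀ n {xs : List A} → Unique xs →
                ∀ {a e} → a ∈ take n xs → e ∈ drop n xs → a ≢ e
  take-drop-≢ (suc n) (x∉ ∷ _)  (here refl) e∈ = All.lookup x∉ (∈-drop⁻ n e∈)
  take-drop-≢ (suc n) (_ ∷ xs!) (there a∈)  e∈ = take-drop-≢ n xs! a∈ e∈

  length-take-≤ : ∀ {n} {xs : List A} → n ≤ length xs → length (take n xs) ≡ n
  length-take-≤ {n} {xs} n≤ = trans (length-take n xs) (m≤n⇒m⊓n≡m n≤)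

  length-filter-¬ : ∀ {P : A → Set} (P? : Decidable₁ P) xs →
                    length (filter P? xs) + length (filter (¬? ∘ P?) xs) ≡ length xs
  length-filter-¬ P? []       = refl
  length-filter-¬ P? (x ∷ xs) with P? x
  ... | yes _ = cong suc (length-filter-¬ P? xs)
  ... | no  _ = trans (+-suc _ _) (cong suc (length-filter-¬ P? xs))

  AllPairs-lookup : ∀ {R : A → A → Set} {xs} → AllPairs R xs →
                    ∀ {i j} → i Fin.< j → R (lookup xs i) (lookup xs j)
  AllPairs-lookup (x~ ∷ _)  {Fin.zero}  {Fin.suc j} _         = All.lookup x~ (∈-lookup j)
  AllPairs-lookup (_ ∷ xs~) {Fin.suc i} {Fin.suc j} (s≤s i<j) = AllPairs-lookup xs~ i<j

  Linked-lookup : ∀ {R : A → A → Set} {xs} → Linked R xs →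
                  ∀ {i j} → toℕ j ≡ suc (toℕ i) → R (lookup xs i) (lookup xs j)
  Linked-lookup (x~ ∷ _)  {Fin.zero}  {Fin.suc Fin.zero} _ = x~
  Linked-lookup (_ ∷ xs~) {Fin.suc i} {Fin.suc j} eq = Linked-lookup xs~ (suc-injective eq)
  Linked-lookup [-] {Fin.zero} {Fin.zero} ()

  Unique-lookup-injective : ∀ {xs : List A} → Unique xs →
                            ∀ {i j} → lookup xs i ≡ lookup xs j → i ≡ j
  Unique-lookup-injective xs! {i} {j} eq with Fin.<-cmp i j
  ... | tri< i<j _ _ = contradiction eq (AllPairs-lookup xs! i<j)
  ... | tri≈ _ i≡j _ = i≡j
  ... | tri> _ _ j<i = contradiction (sym eq) (AllPairs-lookup xs! j<i)

-- Selecting spaced rows from the levels of a tree.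

module Layering
  {A : Set} (dep : A → ℕ) (_⊏_ : A → A → Set) (_⊏?_ : Decidable _⊏_)
  (⊏⇒dep< : ∀ {a e} → a ⊏ e → dep a < dep e)
  (⊏-unique : ∀ {a b e} → a ⊏ e → b ⊏ e → dep a ≡ dep b → a ≡ b)
  where

  -- By `⊏⇒dep<`, `Before Y Z` already excludes proper ancestors in `Z` of elements of `Y`;
  -- `Indep Y Z` excludes the other direction.
  Before Indep : List A → List A → Set
  Before Y Z = ∀ {a e} → a ∈ Y → e ∈ Z → a ≢ e × dep a ≤ dep e
  Indep  Y Z = ∀ {a e} → a ∈ Y → e ∈ Z → ¬ a ⊏ e

  Flat : List A → Set
  Flat Z = ∀ {a e} → a ∈ Z → e ∈ Z → dep a ≡ dep e

  record Row (k : ℕ) (Y : List A) : Set where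
    constructor mkRow
    field
      size   : length Y ≡ k
      unique : Unique Y
      flat   : Flat Y
  open Row

  record Rows (k : ℕ) (xs : List A) : Set where
    field
      Zs      : List (List A)
      rows    : All (Row k) Zs
      ordered : AllPairs Before Zs
      source  : ∀ {Z a} → Z ∈ Zs → a ∈ Z → a ∈ xs

  module _ where
    open Rows

    blocks : ∀ k q xs → q * k ≤ length xs → Unique xs → Flat xs →
             Σ (Rows k xs) λ B → length (Zs B) ≡ q
    blocks k zero    xs _ _ _ = record { Zs = [] ; rows = [] ; ordered = [] ; source = λ () } , refl
    blocks k (suc q) xs k+qk≤ xs! flat-xs
      with blocks k q (drop k xs)
             (≤-trans (≤-reflexive (sym (m+n∸m≡n k (q * k))))
               (≤-trans (∸-monoˡ-≤ k k+qk≤) (≤-reflexive (sym (length-drop k xs)))))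
             (Unique.drop⁺ k xs!) (λ a∈ e∈ → flat-xs (∈-drop⁻ k a∈) (∈-drop⁻ k e∈))
    ... | B , refl = record
      { Zs      = take k xs ∷ Zs B
      ; rows    = mkRow (length-take-≤ (≤-trans (m≤m+n k _) k+qk≤)) (Unique.take⁺ k xs!)
                    (λ a∈ e∈ → flat-xs (∈-take⁻ k a∈) (∈-take⁻ k e∈)) ∷ rows B
      ; ordered = All.tabulate (λ Z∈ a∈ e∈ → let e∈drop = source B Z∈ e∈ in
                    take-drop-≢ k xs! a∈ e∈drop ,
                    ≤-reflexive (flat-xs (∈-take⁻ k a∈) (∈-drop⁻ k e∈drop))) ∷ ordered B
      ; source  = λ { (here refl) a∈ → ∈-take⁻ k a∈ ; (there Z∈) a∈ → ∈-drop⁻ k (source B Z∈ a∈) }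
      } , refl

    -- Each level is cut into blocks separately and leaves fewer than `k` elements over; `D` bounds
    -- the number of levels, whence the term `k * D`.
    levels : ∀ k .{{_ : NonZero k}} D xs → Unique xs → (∀ {a} → a ∈ xs → dep a < D) →
             Σ (Rows k xs) λ B → length xs ≤ k * (length (Zs B) + D)
    levels k zero    []       _ _   =
      record { Zs = [] ; rows = [] ; ordered = [] ; source = λ () } , z≤n
    levels k zero    (x ∷ xs) _ dep<D = contradiction (dep<D (here refl)) λ ()
    levels k (suc D) xs xs! dep<D = record
      { Zs      = Zs L ++ Zs T
      ; rows    = All.++⁺ (rows L) (rows T)
      ; ordered = AllPairs.++⁺ (ordered L) (ordered T)
          (All.tabulate λ Z∈ → All.tabulate λ Z′∈ a∈ e∈ →
            low-before-top (source L Z∈ a∈) (source T Z′∈ e∈))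
      ; source  = λ Z∈ a∈ → case ∈-++⁻ (Zs L) Z∈ of λ
          { (inj₁ Z∈L) → proj₁ (∈-filter⁻ (¬? ∘ top?) (source L Z∈L a∈))
          ; (inj₂ Z∈T) → proj₁ (∈-filter⁻ top? (source T Z∈T a∈)) }
      } , count
      where
      top? : Decidable₁ (λ a → dep a ≡ D)
      top? a = dep a ≟ℕ D
      top low : List A
      top = filter top? xs
      low = filter (¬? ∘ top?) xs
      dep-top : ∀ {a} → a ∈ top → dep a ≡ D
      dep-top a∈ = proj₂ (∈-filter⁻ top? {xs = xs} a∈)
      dep-low : ∀ {a} → a ∈ low → dep a < D
      dep-low a∈ = let (a∈xs , ≢D) = ∈-filter⁻ (¬? ∘ top?) a∈ in ≤∧≢⇒< (s≤s⁻¹ (dep<D a∈xs)) ≢D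
      low-before-top : ∀ {a e} → a ∈ low → e ∈ top → a ≢ e × dep a ≤ dep e
      low-before-top a∈ e∈ =
        (λ { refl → <⇒≢ (dep-low a∈) (dep-top e∈) }) ,
        ≤-trans (<⇒≤ (dep-low a∈)) (≤-reflexive (sym (dep-top e∈)))
      recL = levels k D low (Unique.filter⁺ (¬? ∘ top?) xs!) dep-low
      recT = blocks k (length top / k) top (m/n*n≤m (length top) k) (Unique.filter⁺ top? xs!)
               (λ a∈ e∈ → trans (dep-top a∈) (sym (dep-top e∈)))
      L = proj₁ recL
      T = proj₁ recT
      top≤ : length top ≤ k * suc (length (Zs T))
      top≤ = begin
        length top                              ≡⟨ m≡m%n+[m/n]*n (length top) k ⟩
        length top % k + length top / k * k     ≤⟨ +-monoˡ-≤ _ (<⇒≤ (m%n<n (length top) k)) ⟩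
        suc (length top / k) * k                ≡⟨ *-comm _ k ⟩
        k * suc (length top / k)                ≡⟨ cong (λ q → k * suc q) (proj₂ recT) ⟨
        k * suc (length (Zs T))                 ∎
        where open ≤-Reasoning
      count : length xs ≤ k * (length (Zs L ++ Zs T) + suc D)
      count = begin
        length xs                                               ≡⟨ length-filter-¬ top? xs ⟨
        length top + length low                                 ≤⟨ +-mono-≤ top≤ (proj₂ recL) ⟩
        k * suc (length (Zs T)) + k * (length (Zs L) + D)       ≡⟨ *-distribˡ-+ k _ _ ⟨
        k * (suc (length (Zs T)) + (length (Zs L) + D))         ≡⟨ cong (k *_) (shuffle (length (Zs T)) (length (Zs L)) D) ⟩
        k * (length (Zs L) + length (Zs T) + suc D)             ≡⟨ cong (λ l → k * (l + suc D)) (length-++ (Zs L)) ⟨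
        k * (length (Zs L ++ Zs T) + suc D)                     ∎
        where
        open ≤-Reasoning
        shuffle : ∀ t l D → suc t + (l + D) ≡ l + t + suc D
        shuffle t l D = trans (cong suc (trans (sym (+-assoc t l D)) (cong (_+ D) (+-comm t l))))
                              (sym (+-suc (l + t) D))

  -- Independence is asked of neighbouring rows only: it is what raises the gap between related rows
  -- from one to two.
  record SpacedRowList (k : ℕ) (xs : List (List A)) : Set where
    field
      Ys      : List (List A)
      count   : length Ys ≡ 2 * length xs
      rows    : All (Row k) Ys
      ordered : AllPairs Before Ys
      linked  : Linked Indep Ys
      source  : ∀ {Y a} → Y ∈ Ys → a ∈ Y → ∃[ Z ] (Z ∈ xs × a ∈ Z)

  -- One row c is already taken from the first block Z; the other row of Z is still to be
  -- taken from rest, so as to avoid the descendants of the row preceding it.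
  record Pending (k : ℕ) (Z : List A) (Zs : List (List A)) : Set where
    field
      rest c      : List A
      later       : List (List A)
      rest-unique : Unique rest
      rest-size   : 2 * k ≤ length rest
      rest⊆Z      : ∀ {a} → a ∈ rest → a ∈ Z
      c⊆Z         : ∀ {a} → a ∈ c → a ∈ Z
      rest-c-≢    : ∀ {a e} → a ∈ rest → e ∈ c → a ≢ e
      count       : length later ≡ 2 * length Zs
      rows        : All (Row k) (c ∷ later)
      ordered     : AllPairs Before (c ∷ later)
      linked      : Linked Indep (c ∷ later)
      source      : ∀ {Y a} → Y ∈ later → a ∈ Y → ∃[ Z′ ] (Z′ ∈ Zs × a ∈ Z′)

  -- The rows `b` and `c` lie in one block, so they have equal depth and are independent for free.
  complete : ∀ {k Z Zs b} → Flat Z → All (Before Z) Zs → (P : Pending k Z Zs) →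
             Row k b → (∀ {a} → a ∈ b → a ∈ Pending.rest P) → SpacedRowList k (Z ∷ Zs)
  complete {k} {Z} {Zs} {b} flat-Z Z-before P row-b b⊆rest = record
    { Ys      = b ∷ c ∷ later
    ; count   = trans (cong (2 +_) count) (sym (*-suc 2 (length Zs)))
    ; rows    = row-b ∷ rows
    ; ordered = (b-before-c ∷ All.tabulate b-before-later) ∷ ordered
    ; linked  = (λ a∈ e∈ a⊏e → <⇒≢ (⊏⇒dep< a⊏e) (b-c-dep a∈ e∈)) ∷ linked
    ; source  = λ
        { (here refl) a∈         → Z , here refl , rest⊆Z (b⊆rest a∈)
        ; (there (here refl)) a∈ → Z , here refl , c⊆Z a∈
        ; (there (there Y∈)) a∈  → let (Z′ , Z′∈ , a∈Z′) = source Y∈ a∈ in Z′ , there Z′∈ , a∈Z′ }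
    }
    where
    open Pending P
    b-c-dep : ∀ {a e} → a ∈ b → e ∈ c → dep a ≡ dep e
    b-c-dep a∈ e∈ = flat-Z (rest⊆Z (b⊆rest a∈)) (c⊆Z e∈)
    b-before-c : Before b c
    b-before-c a∈ e∈ = rest-c-≢ (b⊆rest a∈) e∈ , ≤-reflexive (b-c-dep a∈ e∈)
    b-before-later : ∀ {Y} → Y ∈ later → Before b Y
    b-before-later Y∈ a∈ e∈ =
      let (Z′ , Z′∈ , e∈Z′) = source Y∈ e∈ in All.lookup Z-before Z′∈ (rest⊆Z (b⊆rest a∈)) e∈Z′

  Row-take : ∀ {k xs Z} → k ≤ length xs → Unique xs → (∀ {a} → a ∈ xs → a ∈ Z) → Flat Z →
             Row k (take k xs)
  Row-take {k} k≤ xs! ⊆Z flat-Z = mkRow (length-take-≤ k≤) (Unique.take⁺ k xs!)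
    (λ a∈ e∈ → flat-Z (⊆Z (∈-take⁻ k a∈)) (⊆Z (∈-take⁻ k e∈)))

  -- Isolates the choice of `c` and `rest` within `Z₀`. The order conditions are inherited from the
  -- blocks, since the rows of `Q` lie in later ones.
  prepend : ∀ {k Z₀ Zs} → Row (3 * k) Z₀ → All (Before Z₀) Zs → (Q : SpacedRowList k Zs) →
            ∀ {rest c} → Unique rest → 2 * k ≤ length rest →
            (∀ {a} → a ∈ rest → a ∈ Z₀) → (∀ {a} → a ∈ c → a ∈ Z₀) →
            (∀ {a e} → a ∈ rest → e ∈ c → a ≢ e) → Row k c →
            Linked Indep (c ∷ SpacedRowList.Ys Q) → Pending k Z₀ Zs
  prepend {k} {Z₀} {Zs} row₀ Z₀-before Q {rest} {c} rest! size rest⊆ c⊆ rest-c-≢ row-c linked-c = record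
    { rest = rest ; c = c ; later = Ys
    ; rest-unique = rest! ; rest-size = size ; rest⊆Z = rest⊆ ; c⊆Z = c⊆ ; rest-c-≢ = rest-c-≢
    ; count = count ; rows = row-c ∷ rows
    ; ordered = All.tabulate (λ Y∈ a∈ e∈ → let (Z , Z∈ , e∈Z) = source Y∈ e∈ in
                  All.lookup Z₀-before Z∈ (c⊆ a∈) e∈Z) ∷ ordered
    ; linked = linked-c ; source = source }
    where open SpacedRowList Q

  start : ∀ {k Z} → Row (3 * k) Z → Pending k Z []
  start {k} {Z} row = prepend row [] (record { Ys = [] ; count = refl ; rows = [] ; ordered = []
                                             ; linked = [] ; source = λ () })
    (Unique.drop⁺ k (unique row)) size-rest (∈-drop⁻ k) (∈-take⁻ k)
    (λ a∈ e∈ eq → take-drop-≢ k (unique row) e∈ a∈ (sym eq))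
    (Row-take k≤ (unique row) (λ a∈ → a∈) (flat row)) [-]
    where
    k≤ : k ≤ length Z
    k≤ = ≤-trans (m≤m+n k _) (≤-reflexive (sym (size row)))
    size-rest : 2 * k ≤ length (drop k Z)
    size-rest = ≤-reflexive (sym (trans (length-drop k Z) (trans (cong (_∸ k) (size row)) (m+n∸m≡n k _))))

  -- The sets p and q are disjoint and of equal depth, so no vertex lies below both of them, and
  -- one of them has at least k of the 2k vertices of rest not below it.
  advance : ∀ {k Z₀ Z Zs} → Row (3 * k) Z₀ → Row (3 * k) Z → All (Before Z₀) (Z ∷ Zs) →
            All (Before Z) Zs → Pending k Z Zs → Pending k Z₀ (Z ∷ Zs)
  advance {k} {Z₀} {Z} {Zs} row₀ row Z₀-before Z-before P = choose (k ≤? length clear)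
    where
    open Pending P
    p q r : List A
    p = take k Z₀
    q = take k (drop k Z₀)
    r = drop k (drop k Z₀)
    length-drop₁ : length (drop k Z₀) ≡ 2 * k
    length-drop₁ = trans (length-drop k Z₀) (trans (cong (_∸ k) (size row₀)) (m+n∸m≡n k _))
    k≤₁ : k ≤ length Z₀
    k≤₁ = ≤-trans (m≤m+n k _) (≤-reflexive (sym (size row₀)))
    k≤₂ : k ≤ length (drop k Z₀)
    k≤₂ = ≤-trans (m≤m+n k _) (≤-reflexive (sym length-drop₁))
    drop! : Unique (drop k Z₀)
    drop! = Unique.drop⁺ k (unique row₀)
    q⊆drop : ∀ {a} → a ∈ q → a ∈ drop k Z₀
    q⊆drop = ∈-take⁻ k
    p-r-≢ : ∀ {a e} → a ∈ p → e ∈ r → a ≢ e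
    p-r-≢ a∈ e∈ = take-drop-≢ k (unique row₀) a∈ (∈-drop⁻ k e∈)
    p++r⊆ : ∀ {a} → a ∈ p ++ r → a ∈ Z₀
    p++r⊆ a∈ with ∈-++⁻ p a∈
    ... | inj₁ a∈p = ∈-take⁻ k a∈p
    ... | inj₂ a∈r = ∈-drop⁻ k (∈-drop⁻ k a∈r)
    p++r-q-≢ : ∀ {a e} → a ∈ p ++ r → e ∈ q → a ≢ e
    p++r-q-≢ a∈ e∈ with ∈-++⁻ p a∈
    ... | inj₁ a∈p = take-drop-≢ k (unique row₀) a∈p (q⊆drop e∈)
    ... | inj₂ a∈r = λ a≡e → take-drop-≢ k drop! e∈ a∈r (sym a≡e)
    p++r-size : 2 * k ≤ length (p ++ r)
    p++r-size = ≤-reflexive (sym (begin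
      length (p ++ r)                ≡⟨ length-++ p ⟩
      length p + length r            ≡⟨ cong₂ _+_ (length-take-≤ k≤₁) (length-drop k (drop k Z₀)) ⟩
      k + (length (drop k Z₀) ∸ k)   ≡⟨ cong (λ l → k + (l ∸ k)) length-drop₁ ⟩
      k + (2 * k ∸ k)                ≡⟨ cong (k +_) (m+n∸m≡n k _) ⟩
      2 * k                          ∎))
      where open ≡-Reasoning
    below-p? : Decidable₁ (λ e → Any (_⊏ e) p)
    below-p? e = anyL? (_⊏? e) p
    below clear : List A
    below = filter below-p? rest
    clear = filter (¬? ∘ below-p?) rest
    below⊆ : ∀ {a} → a ∈ below → a ∈ rest
    below⊆ a∈ = proj₁ (∈-filter⁻ below-p? a∈)
    clear⊆ : ∀ {a} → a ∈ clear → a ∈ rest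
    clear⊆ a∈ = proj₁ (∈-filter⁻ (¬? ∘ below-p?) a∈)
    p-clear : ∀ {a e} → a ∈ p → e ∈ clear → ¬ a ⊏ e
    p-clear a∈ e∈ a⊏e = proj₂ (∈-filter⁻ (¬? ∘ below-p?) {xs = rest} e∈) (lose a∈ a⊏e)
    q-below : ∀ {a e} → a ∈ q → e ∈ below → ¬ a ⊏ e
    q-below a∈ e∈ a⊏e with find (proj₂ (∈-filter⁻ below-p? {xs = rest} e∈))
    ... | a′ , a′∈ , a′⊏e = take-drop-≢ k (unique row₀) a′∈ (q⊆drop a∈)
      (⊏-unique a′⊏e a⊏e (flat row₀ (∈-take⁻ k a′∈) (∈-drop⁻ k (q⊆drop a∈))))

    choose : Dec (k ≤ length clear) → Pending k Z₀ (Z ∷ Zs)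
    -- `p` becomes a row of `Z₀`, and `k` vertices not below it complete `Z`.
    choose (yes k≤) = prepend row₀ Z₀-before C
      drop! (≤-reflexive (sym length-drop₁)) (∈-drop⁻ k) (∈-take⁻ k)
      (λ a∈ e∈ a≡e → take-drop-≢ k (unique row₀) e∈ a∈ (sym a≡e))
      (Row-take k≤₁ (unique row₀) (λ a∈ → a∈) (flat row₀))
      ((λ a∈ e∈ → p-clear a∈ (∈-take⁻ k e∈)) ∷ SpacedRowList.linked C)
      where
      C : SpacedRowList k (Z ∷ Zs)
      C = complete (flat row) Z-before P
          (Row-take k≤ (Unique.filter⁺ _ rest-unique) (rest⊆Z ∘ clear⊆) (flat row))
          (clear⊆ ∘ ∈-take⁻ k)
    -- At least `k` vertices of `rest` are below `p`, hence not below `q`: now `q` becomes the row,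
    -- and `p ++ r` remains.
    choose (no k≰) = prepend row₀ Z₀-before C
      (AllPairs.++⁺ (Unique.take⁺ k (unique row₀)) (Unique.drop⁺ k drop!)
        (All.tabulate λ a∈ → All.tabulate (p-r-≢ a∈)))
      p++r-size p++r⊆ (∈-drop⁻ k ∘ q⊆drop) p++r-q-≢
      (Row-take k≤₂ drop! (∈-drop⁻ k) (flat row₀))
      ((λ a∈ e∈ → q-below a∈ (∈-take⁻ k e∈)) ∷ SpacedRowList.linked C)
      where
      k≤below : k ≤ length below
      k≤below = +-cancelʳ-≤ k k (length below) (begin
        k + k                           ≡⟨ cong (k +_) (+-identityʳ k) ⟨
        2 * k                           ≤⟨ rest-size ⟩
        length rest                     ≡⟨ length-filter-¬ below-p? rest ⟨
        length below + length clear     ≤⟨ +-monoʳ-≤ (length below) (<⇒≤ (≰⇒> k≰)) ⟩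
        length below + k                ∎)
        where open ≤-Reasoning
      C : SpacedRowList k (Z ∷ Zs)
      C = complete (flat row) Z-before P
          (Row-take k≤below (Unique.filter⁺ _ rest-unique) (rest⊆Z ∘ below⊆) (flat row))
          (below⊆ ∘ ∈-take⁻ k)

  -- Runs from the last block backwards: the second row of a block is chosen together with the first
  -- row of the next one.
  pending : ∀ {k Z Zs} → All (Row (3 * k)) (Z ∷ Zs) → AllPairs Before (Z ∷ Zs) → Pending k Z Zs
  pending {Zs = []}     (row ∷ [])         _ = start row
  pending {Zs = _ ∷ _} (row ∷ row′ ∷ rows) (before ∷ before′ ∷ ordered) =
    advance row row′ before before′ (pending (row′ ∷ rows) (before′ ∷ ordered))

  spacedRowList : ∀ {k Zs} → All (Row (3 * k)) Zs → AllPairs Before Zs → SpacedRowList k Zs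
  spacedRowList {Zs = []}    _ _ = record { Ys = [] ; count = refl ; rows = [] ; ordered = []
                                          ; linked = [] ; source = λ () }
  spacedRowList {k} {Z ∷ Zs} (row ∷ rows) (before ∷ ordered) =
    -- No row precedes the first block, so any `k` vertices of `rest` serve.
    complete (flat row) before P (Row-take (≤-trans (m≤m+n k _) rest-size) rest-unique rest⊆Z (flat row))
      (∈-take⁻ k)
    where
    P : Pending k Z Zs
    P = pending (row ∷ rows) (before ∷ ordered)
    open Pending P using (rest-size; rest-unique; rest⊆Z)

  spacedFamily : ∀ m D xs → Unique xs → (∀ {a} → a ∈ xs → dep a < D) →
                 ∀ k .{{_ : NonZero k}} → 3 * k * (m + D) ≤ length xs → k ≤ 2 * m →
                 Σ (Fin k → Fin k → A) λ y →
                   (∀ i j → y i j ∈ xs) ×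
                   (∀ {i j i′ j′} → y i j ≡ y i′ j′ → (i , j) ≡ (i′ , j′)) ×
                   (∀ {i j i′ j′} → y i j ⊏ y i′ j′ → 2 + toℕ i ≤ toℕ i′)
  spacedFamily m D xs xs! dep<D k size≥ k≤2m = y , y∈ , y-inj , y-spaced
    where
    instance
      3k≢0 : NonZero (3 * k)
      3k≢0 = m*n≢0 3 k
    L = levels (3 * k) D xs xs! dep<D
    module L = Rows (proj₁ L)
    m≤ : m ≤ length L.Zs
    -- After the loss of at most `3 * k` per level, `m` blocks remain, and each gives two rows.
    m≤ = +-cancelʳ-≤ D m _ (*-cancelˡ-≤ (3 * k) (≤-trans size≥ (proj₂ L)))
    open SpacedRowList (spacedRowList {k} L.rows L.ordered)
    k≤ : k ≤ length Ys
    k≤ = ≤-trans k≤2m (≤-trans (*-monoʳ-≤ 2 m≤) (≤-reflexive (sym count)))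
    Y : Fin k → List A
    Y i = lookup Ys (Fin.inject≤ i k≤)
    toℕ-Y : ∀ i → toℕ (Fin.inject≤ i k≤) ≡ toℕ i
    toℕ-Y i = Fin.toℕ-inject≤ i k≤
    Y-row : ∀ i → Row k (Y i)
    Y-row i = All.lookup rows (∈-lookup _)
    y : Fin k → Fin k → A
    y i j = lookup (Y i) (Fin.cast (sym (size (Y-row i))) j)
    y∈Y : ∀ i j → y i j ∈ Y i
    y∈Y i j = ∈-lookup _
    y∈ : ∀ i j → y i j ∈ xs
    y∈ i j = let (_ , Z∈ , y∈Z) = source (∈-lookup _) (y∈Y i j) in L.source Z∈ y∈Z
    before : ∀ {i i′} → toℕ i < toℕ i′ → ∀ j j′ → y i j ≢ y i′ j′ × dep (y i j) ≤ dep (y i′ j′)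
    before {i} {i′} i<i′ j j′ =
      AllPairs-lookup ordered (subst₂ _<_ (sym (toℕ-Y i)) (sym (toℕ-Y i′)) i<i′) (y∈Y i j) (y∈Y i′ j′)
    y-inj : ∀ {i j i′ j′} → y i j ≡ y i′ j′ → (i , j) ≡ (i′ , j′)
    y-inj {i} {j} {i′} {j′} eq with Fin.<-cmp i i′
    ... | tri< i<i′ _ _ = contradiction eq (proj₁ (before i<i′ j j′))
    ... | tri> _ _ i′<i = contradiction (sym eq) (proj₁ (before i′<i j′ j))
    ... | tri≈ _ refl _ = cong (i ,_) (Fin.toℕ-injective
      (trans (sym (Fin.toℕ-cast _ j)) (trans
        (cong toℕ (Unique-lookup-injective (unique (Y-row i)) eq)) (Fin.toℕ-cast _ j′))))
    y-spaced : ∀ {i j i′ j′} → y i j ⊏ y i′ j′ → 2 + toℕ i ≤ toℕ i′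
    y-spaced {i} {j} {i′} {j′} y⊏y′ with Fin.<-cmp i i′
    ... | tri> _ _ i′<i = contradiction (proj₂ (before i′<i j′ j)) (<⇒≱ (⊏⇒dep< y⊏y′))
    ... | tri≈ _ refl _ =
      contradiction (flat (Y-row i) (y∈Y i j) (y∈Y i j′)) (<⇒≢ (⊏⇒dep< y⊏y′))
    -- Only `i′ = i + 1` is left to exclude, which is independence of neighbouring rows.
    ... | tri< i<i′ _ _ = ≤∧≢⇒< i<i′ λ adjacent →
      Linked-lookup linked (trans (toℕ-Y i′) (trans (sym adjacent) (cong suc (sym (toℕ-Y i)))))
        (y∈Y i j) (y∈Y i′ j′) y⊏y′

shallow⇒spacedRows : ∀ {G} m .{{_ : NonZero m}} (S : SpanningSequence G (suc (18 * (m * m)))) →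
                     let open SpanningSequence S in
                     (∀ {t} → t < suc (18 * (m * m)) → suc (dep t) ≤ 2 * m) →
                     SpacedRows tree (2 * m) (suc (18 * (m * m)))
shallow⇒spacedRows m S shallow = record
  { y        = proj₁ family
  ; y<N      = λ i j → s≤s (∈-upTo⁻ (proj₁ (proj₂ family) i j))
  ; y-inj    = proj₁ (proj₂ (proj₂ family))
  ; y-spaced = proj₂ (proj₂ (proj₂ family))
  }
  where
  open SpanningSequence S
  open Layering (dep ∘ suc) (λ a e → suc a ⊏ suc e) (λ a e → suc a ⊏? suc e) (λ {a} {e} → ⊏⇒dep< {suc a} {suc e})
    (λ {a} {b} {e} p q eq → suc-injective (⊏-unique {t = suc e} p q eq))
  enough : ∀ m → 3 * (2 * m) * (m + 2 * m) ≡ 18 * (m * m)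
  enough = solve-∀
  instance
    2m≢0 : NonZero (2 * m)
    2m≢0 = m*n≢0 2 m
  -- The 18 m² non-root vertices allow for `m` blocks of 6m vertices and a loss of 6m on each of 2m
  -- levels. The root is left out because every selected vertex needs a parent.
  family = spacedFamily m (2 * m) (upTo (18 * (m * m))) (Unique.upTo⁺ _)
    (λ a∈ → shallow (s≤s (∈-upTo⁻ a∈))) (2 * m)
    (≤-reflexive (trans (enough m) (sym (length-upTo _)))) ≤-refl

module _ (G₁ G₂ : Graph) (conn₁ : Connected G₁) (conn₂ : Connected G₂) where

  grid-1 : 1 ≤ ∣V∣ G₁ → 1 ≤ ∣V∣ G₂ → GridMinor 1 (G₁ □ G₂)
  grid-1 1≤₁ 1≤₂ = grid-of-paths
    (rootPath (spanningSequence G₁ conn₁ 0 1≤₁) (s≤s z≤n) (s≤s z≤n))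
    (rootPath (spanningSequence G₂ conn₂ 0 1≤₂) (s≤s z≤n) (s≤s z≤n))

  grid-2m : ∀ m .{{_ : NonZero m}} → 18 * (m * m) < ∣V∣ G₁ → 18 * (m * m) < ∣V∣ G₂ →
            GridMinor (2 * m) (G₁ □ G₂)
  grid-2m m N≤₁ N≤₂ = by-depth (deep? S₁) (deep? S₂)
    where
    N = suc (18 * (m * m))
    S₁ : SpanningSequence G₁ N
    S₁ = spanningSequence G₁ conn₁ _ N≤₁
    S₂ : SpanningSequence G₂ N
    S₂ = spanningSequence G₂ conn₂ _ N≤₂
    Deep : ∀ {G} → SpanningSequence G N → Set
    Deep S = ∃[ t ] (t < N × 2 * m ≤ suc (SpanningSequence.dep S t))
    deep? : ∀ {G} (S : SpanningSequence G N) → Dec (Deep S)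
    deep? S = anyUpTo? (λ t → 2 * m ≤? suc (SpanningSequence.dep S t)) N
    spaced : ∀ {G} (S : SpanningSequence G N) → ¬ Deep S → SpacedRows (SpanningSequence.tree S) (2 * m) N
    spaced S ¬deep = shallow⇒spacedRows m S λ t<N → ≰⇒≥ λ 2m≤ → ¬deep (_ , t<N , 2m≤)
    4m²≤N : 2 * m * (2 * m) ≤ N
    4m²≤N = begin
      2 * m * (2 * m)   ≡⟨ square m ⟩
      4 * (m * m)       ≤⟨ *-monoˡ-≤ (m * m) (m≤m+n 4 14) ⟩
      18 * (m * m)      ≤⟨ n≤1+n _ ⟩
      N                 ∎
      where
      open ≤-Reasoning
      square : ∀ m → 2 * m * (2 * m) ≡ 4 * (m * m)
      square = solve-∀
    by-depth : Dec (Deep S₁) → Dec (Deep S₂) → GridMinor (2 * m) (G₁ □ G₂)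
    by-depth (yes (_ , t<N , deep₁)) (yes (_ , s<N , deep₂)) =
      grid-of-paths (rootPath S₁ t<N deep₁) (rootPath S₂ s<N deep₂)
    by-depth _ (no ¬deep₂) = grid-of-spacedRows S₁ S₂ 4m²≤N (spaced S₂ ¬deep₂)
    by-depth (no ¬deep₁) _ =
      minor-swap G₁ G₂ (grid-of-spacedRows S₂ S₁ 4m²≤N (spaced S₁ ¬deep₁))

-- `m` is the integer square root of `n / d`; it grows by at most one when `n` does.
square-bracket : ∀ d .{{_ : NonZero d}} n → ∃[ m ] (d * (m * m) < suc n × suc n ≤ d * (suc m * suc m))
square-bracket d zero    =
  0 , s≤s (≤-reflexive (*-zeroʳ d)) , ≤-trans (>-nonZero⁻¹ d) (≤-reflexive (sym (*-identityʳ d)))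
square-bracket d (suc n) with square-bracket d n
... | m , lower , upper with suc (suc n) ≤? d * (suc m * suc m)
...   | yes n< = m , m≤n⇒m≤1+n lower , n<
...   | no  n≮ = suc m , ≰⇒> n≮ ,
  ≤-<-trans upper (*-monoʳ-< d (*-mono-< (n<1+n (suc m)) (n<1+n (suc m))))

-- The bound `n ≤ d * (k * k)` expresses `k ≥ c √n` with `c = 1/√d`, here 1/√18, free of real
-- numbers.
theorem7 : ∃[ d ] ((n : ℕ) → 1 ≤ n → (G₁ G₂ : Graph) →
    Connected G₁ → Connected G₂ →
    n ≤ ∣V∣ G₁ → n ≤ ∣V∣ G₂ →
    ∃[ k ] (GridMinor k (G₁ □ G₂) × n ≤ d * (k * k)))
theorem7 = 18 , grid
  where
  grid : (n : ℕ) → 1 ≤ n → (G₁ G₂ : Graph) → Connected G₁ → Connected G₂ →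
         n ≤ ∣V∣ G₁ → n ≤ ∣V∣ G₂ → ∃[ k ] (GridMinor k (G₁ □ G₂) × n ≤ 18 * (k * k))
  grid (suc n) 1≤n G₁ G₂ conn₁ conn₂ n≤₁ n≤₂ with square-bracket 18 n
  -- At most 18 vertices are asked for, so the 1 × 1 grid is enough.
  ... | zero , _ , n≤18 =
    1 , grid-1 G₁ G₂ conn₁ conn₂ (≤-trans 1≤n n≤₁) (≤-trans 1≤n n≤₂) , n≤18
  -- With M = `suc m`, the lower bound provides the 18 M² + 1 tree vertices, and M + 1 ≤ 2M turns
  -- the upper one into the claim for the grid of side 2M.
  ... | suc m , lower , upper =
    2 * suc m , grid-2m G₁ G₂ conn₁ conn₂ (suc m) (≤-trans lower n≤₁) (≤-trans lower n≤₂) ,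
    ≤-trans upper (*-monoʳ-≤ 18 (*-mono-≤ bound bound))
    where
    bound : suc (suc m) ≤ 2 * suc m
    bound = +-mono-≤ (s≤s (z≤n {m})) (m≤m+n (suc m) 0)
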